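{- For every graph $G$ we have $\mathsf{tree}\text{ - }\alpha(G)\le\alpha(G)$.
   Context: All graphs are finite, simple, and undirected; $\alpha(G)$ denotes the maximum size of an independent set in $G$. A tree decomposition of a graph $G$ is a pair $\mathcal{T}=(T,\{X_t\}_{t\in V(T)})$ where $T$ is a tree and each node $t$ is assigned a bag $X_t\subseteq V(G)$ such that every vertex of $G$ is in at least one bag, every edge of $G$ has both endpoints in some common bag, and for every $u\in V(G)$ the subgraph of $T$ induced by $\{t: u\in X_t\}$ is connected. The independence number of $\mathcal{T}$ is $\alpha(\mathcal{T})=\max_{t\in V(T)}\alpha(G[X_t])$. The tree-independence number $\mathsf{tree}\text{ - }\alpha(G)$ is the minimum of $\alpha(\mathcal{T})$ over all tree decompositions $\mathcal{T}$ of $G$. -}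

module Defs where

open import Level using (0ℓ)
open import Data.Bool using (true; false)
open import Data.Nat using (ℕ; zero; suc; _+_; _≤_)
open import Data.Nat.Properties using (≮⇒≥; ≤-antisym; ≤-reflexive)
open import Data.Nat.Induction using (<-rec)
open import Data.Fin using (Fin; zero; suc; inject₁; fromℕ)
open import Data.Fin.Properties using (all?; suc-injective)
open import Data.Fin.Subset using (Subset; inside; outside; _∈_; ∣_∣; ⊥)
open import Data.Fin.Subset.Properties using (_∈?_; ∉⊥; ∣⊥∣≡0)
open import Data.Vec using ([]; _∷_; lookup; tabulate; here; there)
open import Data.List using (List; []; _∷_; _++_; map; filter; allFin)
open import Data.List.Extrema.Nat using (max; v≤max⁺; argmax-sel)
open import Data.List.Membership.Propositional using () renaming (_∈_ to _∈ˡ_)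
open import Data.List.Membership.Propositional.Properties using (∈-++⁺ˡ; ∈-++⁺ʳ; ∈-map⁺; ∈-map⁻; ∈-filter⁺; ∈-filter⁻)
open import Data.List.Relation.Unary.Any as Any using ()
open import Data.Product using (Σ; ∃; ∃-syntax; _×_; _,_; proj₂)
open import Data.Sum using (inj₁; inj₂)
open import Function using (id)
open import Function.Definitions using (Injective)
open import Relation.Nullary using (¬_; Dec; ¬?)
open import Relation.Nullary.Decidable using (_→-dec_)
open import Relation.Binary using (Rel; Symmetric; Decidable)
open import Relation.Binary.Construct.Closure.ReflexiveTransitive using (Star)
open import Relation.Binary.PropositionalEquality using (_≡_; refl; sym; cong)

-- Finite simple undirected graphs, with vertex set Fin n.
record Graph (n : ℕ) : Set₁ where
  field
    Adj    : Rel (Fin n) 0ℓ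
    adj?   : Decidable Adj
    symm   : Symmetric Adj
    irrefl : ∀ v → ¬ Adj v v

open Graph public

-- The increasing enumeration of the elements of X.
embed : ∀ {n} (X : Subset n) → Fin ∣ X ∣ → Fin n
embed (true  ∷ X) zero    = zero
embed (true  ∷ X) (suc i) = suc (embed X i)
embed (false ∷ X) i       = suc (embed X i)

embed-∈ : ∀ {n} (X : Subset n) i → embed X i ∈ X
embed-∈ (true  ∷ X) zero    = here
embed-∈ (true  ∷ X) (suc i) = there (embed-∈ X i)
embed-∈ (false ∷ X) i       = there (embed-∈ X i)

embed-injective : ∀ {n} (X : Subset n) → Injective _≡_ _≡_ (embed X)
embed-injective (true  ∷ X) {zero}  {zero}  _  = refl
embed-injective (true  ∷ X) {suc i} {suc j} eq = cong suc (embed-injective X (suc-injective eq))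
embed-injective (false ∷ X) eq = embed-injective X (suc-injective eq)

embed-surjective : ∀ {n} (X : Subset n) {v} → v ∈ X → ∃[ i ] embed X i ≡ v
embed-surjective (true  ∷ X) here = zero , refl
embed-surjective (true  ∷ X) (there v∈X) with embed-surjective X v∈X
... | i , refl = suc i , refl
embed-surjective (false ∷ X) (there v∈X) with embed-surjective X v∈X
... | i , refl = i , refl

-- The induced subgraph G[X], its vertices renumbered along embed X.
_⟦_⟧ : ∀ {n} → Graph n → (X : Subset n) → Graph ∣ X ∣
G ⟦ X ⟧ = record
  { Adj    = λ i j → Adj G (embed X i) (embed X j)
  ; adj?   = λ i j → adj? G (embed X i) (embed X j)
  ; symm   = symm G
  ; irrefl = λ i → irrefl G (embed X i)
  }

IsIndependent : ∀ {n} → Graph n → Subset n → Set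
IsIndependent G S = ∀ u v → u ∈ S → v ∈ S → ¬ Adj G u v

isIndependent? : ∀ {n} (G : Graph n) (S : Subset n) → Dec (IsIndependent G S)
isIndependent? G S =
  all? λ u → all? λ v → (u ∈? S) →-dec ((v ∈? S) →-dec ¬? (adj? G u v))

subsets : ∀ n → List (Subset n)
subsets zero    = [] ∷ []
subsets (suc n) = map (outside ∷_) (subsets n) ++ map (inside ∷_) (subsets n)

-- The default value 0 of max is harmless: the empty set is independent.
α : ∀ {n} → Graph n → ℕ
α {n} G = max 0 (map ∣_∣ (filter (isIndependent? G) (subsets n)))

subsets-complete : ∀ {n} (S : Subset n) → S ∈ˡ subsets n
subsets-complete []          = Any.here refl
subsets-complete (false ∷ S) = ∈-++⁺ˡ (∈-map⁺ (outside ∷_) (subsets-complete S))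
subsets-complete {suc n} (true ∷ S) =
  ∈-++⁺ʳ (map (outside ∷_) (subsets n)) (∈-map⁺ (inside ∷_) (subsets-complete S))

α-upper : ∀ {n} (G : Graph n) (S : Subset n) → IsIndependent G S → ∣ S ∣ ≤ α G
α-upper G S ind = v≤max⁺ 0 _
  (inj₂ (Any.map ≤-reflexive
    (∈-map⁺ ∣_∣ (∈-filter⁺ (isIndependent? G) (subsets-complete S) ind))))

α-attained : ∀ {n} (G : Graph n) → ∃[ S ] (IsIndependent G S × ∣ S ∣ ≡ α G)
α-attained {n} G
  with argmax-sel id 0 (map ∣_∣ (filter (isIndependent? G) (subsets n)))
... | inj₁ α≡0 rewrite α≡0 = ⊥ , (λ _ _ u∈⊥ _ _ → ∉⊥ u∈⊥) , ∣⊥∣≡0 n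
... | inj₂ α∈ with ∈-map⁻ ∣_∣ α∈
...   | S , S∈ , α≡∣S∣ =
  S , proj₂ (∈-filter⁻ (isIndependent? G) {xs = subsets n} S∈) , sym α≡∣S∣

-- Connected graphs are nonempty.
IsConnected : ∀ {n} → Graph n → Set
IsConnected {n} G = Fin n × (∀ u v → Star (Adj G) u v)

-- A cycle with k + 3 vertices c 0, …, c (k + 2).
record Cycle {n : ℕ} (G : Graph n) (k : ℕ) : Set where
  field
    c        : Fin (3 + k) → Fin n
    distinct : Injective _≡_ _≡_ c
    step     : ∀ (i : Fin (2 + k)) → Adj G (c (inject₁ i)) (c (suc i))
    close    : Adj G (c (fromℕ (2 + k))) (c zero)

IsAcyclic : ∀ {n} → Graph n → Set
IsAcyclic G = ∀ k → ¬ Cycle G k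

IsTree : ∀ {n} → Graph n → Set
IsTree T = IsConnected T × IsAcyclic T

nodesOf : ∀ {n m} → (Fin m → Subset n) → Fin n → Subset m
nodesOf bag u = tabulate (λ t → lookup (bag t) u)

record TreeDecomposition {n : ℕ} (G : Graph n) : Set₁ where
  field
    {size}       : ℕ
    T            : Graph size
    isTree       : IsTree T
    bag          : Fin size → Subset n
    coversVertex : ∀ u → ∃[ t ] u ∈ bag t
    coversEdge   : ∀ u v → Adj G u v → ∃[ t ] (u ∈ bag t × v ∈ bag t)
    connected    : ∀ u → IsConnected (T ⟦ nodesOf bag u ⟧)

-- The default value 0 of max is harmless: a tree has a node.
αᵀ : ∀ {n} {G : Graph n} → TreeDecomposition G → ℕ
αᵀ {G = G} 𝒯 = max 0 (map (λ t → α (G ⟦ bag t ⟧)) (allFin size))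
  where open TreeDecomposition 𝒯

IsMinimum : (ℕ → Set₁) → ℕ → Set₁
IsMinimum P k = P k × (∀ j → P j → k ≤ j)

-- "tree-α(G) = k".  The minimum ranges over an infinite family, so it is given
-- as a relation; it is single-valued, and classically total on inhabited P,
-- by the two lemmas below.
TreeAlphaIs : ∀ {n} → Graph n → ℕ → Set₁
TreeAlphaIs G = IsMinimum (λ k → Σ (TreeDecomposition G) λ 𝒯 → αᵀ 𝒯 ≡ k)

minimum-unique : ∀ {P k l} → IsMinimum P k → IsMinimum P l → k ≡ l
minimum-unique (Pk , k≤) (Pl , l≤) = ≤-antisym (k≤ _ Pl) (l≤ _ Pk)

minimum-¬¬exists : ∀ {P : ℕ → Set₁} j → P j → ¬ ¬ ∃ (IsMinimum P)
minimum-¬¬exists {P} j Pj none =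
  <-rec (λ j → ¬ P j)
    (λ j rec Pj → none (j , Pj , λ i Pi → ≮⇒≥ (λ i<j → rec i<j Pi))) j Pj

{-# OPTIONS --safe #-}
-- Pushing an independent set of G[X] forward along the inclusion X ⊆ V(G) shows
-- α(G[X]) ≤ α(G), so every tree decomposition, in particular one attaining
-- the minimum, has independence number at most α(G).
module Submission where

open import Defs
open import Data.Bool using (true; false)
open import Data.Nat using (ℕ; _≤_; z≤n; suc)
open import Data.Fin using (zero; suc)
open import Data.Fin.Subset using (Subset; _∈_; ∣_∣)
open import Data.List using (allFin)
open import Data.List.Extrema.Nat using (max≤v⁺)
open import Data.List.Relation.Unary.All using (universal)
open import Data.List.Relation.Unary.All.Properties using (map⁺)
open import Data.Product using (∃-syntax; _×_; _,_)
open import Data.Vec using ([]; _∷_; here; there)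
open import Relation.Binary.PropositionalEquality using (_≡_; refl; cong; sym)

-- The direct image of `S` under `embed X`, defined by the same recursion on `X` as `embed`, so that
-- size and membership follow by matching cases.
image : ∀ {n} (X : Subset n) → Subset ∣ X ∣ → Subset n
image []          S       = []
image (true  ∷ X) (s ∷ S) = s ∷ image X S
image (false ∷ X) S       = false ∷ image X S

∣image∣ : ∀ {n} (X : Subset n) (S : Subset ∣ X ∣) → ∣ image X S ∣ ≡ ∣ S ∣
∣image∣ []          []          = refl
∣image∣ (true  ∷ X) (true  ∷ S) = cong suc (∣image∣ X S)
∣image∣ (true  ∷ X) (false ∷ S) = ∣image∣ X S
∣image∣ (false ∷ X) S           = ∣image∣ X S

∈-image⁻ : ∀ {n} (X : Subset n) (S : Subset ∣ X ∣) {v} →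
           v ∈ image X S → ∃[ i ] (i ∈ S × embed X i ≡ v)
∈-image⁻ (true ∷ X) (true ∷ S) here = zero , here , refl
∈-image⁻ (true ∷ X) (s ∷ S) (there v∈) with ∈-image⁻ X S v∈
... | i , i∈S , refl = suc i , there i∈S , refl
∈-image⁻ (false ∷ X) S (there v∈) with ∈-image⁻ X S v∈
... | i , i∈S , refl = i , i∈S , refl

image-independent : ∀ {n} (G : Graph n) (X : Subset n) (S : Subset ∣ X ∣) →
                    IsIndependent (G ⟦ X ⟧) S → IsIndependent G (image X S)
image-independent G X S ind u v u∈ v∈ with ∈-image⁻ X S u∈ | ∈-image⁻ X S v∈
-- Adjacency in `G ⟦ X ⟧` is by definition adjacency in `G` of the embedded vertices.
... | i , i∈S , refl | j , j∈S , refl = ind i j i∈S j∈S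

α-induced≤α : ∀ {n} (G : Graph n) (X : Subset n) → α (G ⟦ X ⟧) ≤ α G
α-induced≤α G X with α-attained (G ⟦ X ⟧)
-- `S` is a maximum independent set; the rewrites turn the goal into `∣ image X S ∣ ≤ α G`.
... | S , ind , ∣S∣≡α rewrite sym ∣S∣≡α | sym (∣image∣ X S) =
  α-upper G (image X S) (image-independent G X S ind)

αᵀ≤α : ∀ {n} {G : Graph n} (𝒯 : TreeDecomposition G) → αᵀ 𝒯 ≤ α G
αᵀ≤α {G = G} 𝒯 =
  -- `z≤n` bounds the default value 0 of the maximum.
  max≤v⁺ z≤n (map⁺ (universal (λ t → α-induced≤α G (bag t)) (allFin size)))
  where open TreeDecomposition 𝒯

mainTheorem14 : (n : ℕ) (G : Graph n) (k : ℕ) → TreeAlphaIs G k → k ≤ α G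
-- The minimum is attained: `refl` replaces `k` by `αᵀ 𝒯`.
mainTheorem14 n G k ((𝒯 , refl) , _) = αᵀ≤α 𝒯
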